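{- Let $\tau>1$ and let $C(x)=\tau^x$. Let $\ell\geq 1$ be an integer. For any nonnegative $p$, $\mu$, $c$, $d$ and nonnegative $a_i,b_i$ $(i=1,2,\ldots,\ell)$, the maximum of \[C\Big(\mu-\Big(\sum_{i=1}^{\ell}k_i a_i+c\Big)\Big)+C\Big(\mu-\Big(\sum_{i=1}^{\ell}k_i b_i+d\Big)\Big)\] over all $k_1,k_2,\ldots,k_\ell\geq 0$ subject to $k_1+k_2+\cdots+k_\ell=p$ is equal to the maximum of \[C(\mu-(p\,a_i+c))+C(\mu-(p\,b_i+d))\] over all $i=1,2,\ldots,\ell$.
   Context: All quantities other than the integer $\ell$ are real numbers. -}

module Defs where

open import Level using (suc; _⊔_)
open import Algebra.Bundles using (CommutativeRing)
import Algebra.Properties.Semiring.Mult as Mult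
open import Data.Integer.Base using (ℤ; +_; -[1+_])
open import Data.Nat.Base as ℕ using (ℕ; zero; s≤s; z≤n)
import Data.Nat.Properties as ℕ
open import Data.Product.Base using (∃; _×_; _,_; proj₁; proj₂)
open import Data.Rational.Unnormalised.Base using (ℚᵘ; mkℚᵘ; ↥_; ↧ₙ_)
open import Data.Sum.Base using (inj₁; inj₂)
import Relation.Binary.PropositionalEquality.Core as ≡
open import Relation.Binary.Bundles using (DecTotalOrder)
open import Relation.Binary.Core using (Rel)
open import Relation.Binary.Structures using (IsDecTotalOrder)
open import Relation.Nullary.Negation using (¬_; contradiction)
open import Relation.Unary using (Pred; Satisfiable)

module Extrema {a ℓ₁ ℓ₂} {A : Set a} (_≈_ : Rel A ℓ₁) (_≤_ : Rel A ℓ₂) where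

  UpperBound : ∀ {p} → Pred A p → A → Set (a ⊔ ℓ₂ ⊔ p)
  UpperBound S b = ∀ {x} → S x → x ≤ b

  IsSupremum : ∀ {p} → Pred A p → A → Set (a ⊔ ℓ₂ ⊔ p)
  IsSupremum S s = UpperBound S s × (∀ {b} → UpperBound S b → s ≤ b)

  -- m is the maximum (attained) of f i over all i satisfying P.
  IsMaximum : ∀ {i p} {I : Set i} → Pred I p → (I → A) → A →
              Set (i ⊔ p ⊔ ℓ₁ ⊔ ℓ₂)
  IsMaximum P f m = (∃ λ i → P i × f i ≈ m) × (∀ i → P i → f i ≤ m)

-- The real numbers, given by their axioms: a Dedekind-complete ordered
-- field, which is unique up to isomorphism.  Classically, decidability of
-- the order and the Archimedean property follow from the other axioms;
-- they are fields because constructively they do not.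
record RealField r : Set (suc r) where
  field
    commutativeRing : CommutativeRing r r

  open CommutativeRing commutativeRing public
  open Mult semiring public using () renaming (_×_ to infixr 8 _·_)

  infix 4 _≤_
  field
    _≤_             : Rel Carrier r
    isDecTotalOrder : IsDecTotalOrder _≈_ _≤_

  open Extrema _≈_ _≤_ public

  field
    0≉1           : 0# ≉ 1#
    inverse       : ∀ {x} → x ≉ 0# → ∃ λ y → x * y ≈ 1#
    +-monoˡ-≤     : ∀ {x y} z → x ≤ y → x + z ≤ y + z
    *-nonNegative : ∀ {x y} → 0# ≤ x → 0# ≤ y → 0# ≤ x * y
    archimedean   : ∀ x → ∃ λ n → x ≤ n · 1#
    complete      : (S : Pred Carrier r) → Satisfiable S →
                    ∃ (UpperBound S) → ∃ (IsSupremum S)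

  decTotalOrder : DecTotalOrder r r r
  decTotalOrder = record { isDecTotalOrder = isDecTotalOrder }

  open IsDecTotalOrder isDecTotalOrder public using (_≤?_; _≟_; total; antisym)
    renaming (refl to ≤-refl; reflexive to ≤-reflexive; trans to ≤-trans)
  open import Relation.Binary.Properties.DecTotalOrder decTotalOrder public
    using (_<_)

module OrderProperties {r} (ℝ : RealField r) where
  open RealField ℝ
  open import Algebra.Properties.Semiring.Exp semiring using (_^_)
  open import Algebra.Properties.Ring ring
    using (-‿distribˡ-*; -‿distribʳ-*; -‿involutive; x[y-z]≈xy-xz; [y-z]x≈yx-zx)
  open import Relation.Binary.Reasoning.PartialOrder
    (DecTotalOrder.poset decTotalOrder)

  +-monoʳ-≤ : ∀ {x y} z → x ≤ y → z + x ≤ z + y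
  +-monoʳ-≤ {x} {y} z x≤y = begin
    z + x ≈⟨ +-comm z x ⟩
    x + z ≤⟨ +-monoˡ-≤ z x≤y ⟩
    y + z ≈⟨ +-comm y z ⟩
    z + y ∎

  ≤⇒0≤- : ∀ {x y} → x ≤ y → 0# ≤ y - x
  ≤⇒0≤- {x} {y} x≤y = begin
    0#    ≈⟨ -‿inverseʳ x ⟨
    x - x ≤⟨ +-monoˡ-≤ (- x) x≤y ⟩
    y - x ∎

  0≤-⇒≤ : ∀ {x y} → 0# ≤ y - x → x ≤ y
  0≤-⇒≤ {x} {y} p = begin
    x             ≈⟨ +-identityˡ x ⟨
    0# + x        ≤⟨ +-monoˡ-≤ x p ⟩
    (y - x) + x   ≈⟨ +-assoc y (- x) x ⟩
    y + (- x + x) ≈⟨ +-congˡ (-‿inverseˡ x) ⟩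
    y + 0#        ≈⟨ +-identityʳ y ⟩
    y             ∎

  neg-antimono : ∀ {x y} → - x ≤ y → - y ≤ x
  neg-antimono {x} {y} p = 0≤-⇒≤ (begin
    0#          ≤⟨ ≤⇒0≤- p ⟩
    y - (- x)   ≈⟨ +-congˡ (-‿involutive x) ⟩
    y + x       ≈⟨ +-comm y x ⟩
    x + y       ≈⟨ +-congˡ (-‿involutive y) ⟨
    x - (- y)   ∎)

  *-monoˡ-≤ : ∀ {x y z} → 0# ≤ z → x ≤ y → x * z ≤ y * z
  *-monoˡ-≤ {x} {y} {z} 0≤z x≤y = 0≤-⇒≤ (begin
    0#            ≤⟨ *-nonNegative (≤⇒0≤- x≤y) 0≤z ⟩
    (y - x) * z   ≈⟨ [y-z]x≈yx-zx z y x ⟩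
    y * z - x * z ∎)

  *-mono-≤ : ∀ {w x y z} → 0# ≤ w → 0# ≤ y → w ≤ x → y ≤ z → w * y ≤ x * z
  *-mono-≤ {w} {x} {y} {z} 0≤w 0≤y w≤x y≤z = begin
    w * y ≤⟨ *-monoˡ-≤ 0≤y w≤x ⟩
    x * y ≈⟨ *-comm x y ⟩
    y * x ≤⟨ *-monoˡ-≤ (≤-trans 0≤w w≤x) y≤z ⟩
    z * x ≈⟨ *-comm z x ⟩
    x * z ∎

  0≤1 : 0# ≤ 1#
  0≤1 with total 0# 1#
  ... | inj₁ p = p
  ... | inj₂ p = begin
    0#            ≤⟨ *-nonNegative 0≤-1 0≤-1 ⟩
    - 1# * - 1#   ≈⟨ -‿distribʳ-* (- 1#) 1# ⟨
    - (- 1# * 1#) ≈⟨ -‿cong (*-identityʳ (- 1#)) ⟩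
    - (- 1#)      ≈⟨ -‿involutive 1# ⟩
    1#            ∎
    where
    0≤-1 : 0# ≤ - 1#
    0≤-1 = ≤-trans (≤⇒0≤- p) (≤-reflexive (+-identityˡ (- 1#)))

  1≰0 : ¬ (1# ≤ 0#)
  1≰0 p = 0≉1 (antisym 0≤1 p)

  1≤⇒0≤ : ∀ {x} → 1# ≤ x → 0# ≤ x
  1≤⇒0≤ = ≤-trans 0≤1

  1≤* : ∀ {x y} → 1# ≤ x → 1# ≤ y → 1# ≤ x * y
  1≤* p q = ≤-trans (≤-reflexive (sym (*-identityˡ 1#))) (*-mono-≤ 0≤1 0≤1 p q)

  1≤^ : ∀ {x} n → 1# ≤ x → 1# ≤ x ^ n
  1≤^ zero      p = ≤-refl
  1≤^ (ℕ.suc n) p = 1≤* p (1≤^ n p)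

  ^-monoˡ-≤ : ∀ {x y} n → 0# ≤ x → x ≤ y → x ^ n ≤ y ^ n
  ^-monoˡ-≤ zero      0≤x x≤y = ≤-refl
  ^-monoˡ-≤ {x} (ℕ.suc n) 0≤x x≤y =
    *-mono-≤ 0≤x (0≤^ n) x≤y (^-monoˡ-≤ n 0≤x x≤y)
    where
    0≤^ : ∀ n → 0# ≤ x ^ n
    0≤^ zero      = 0≤1
    0≤^ (ℕ.suc n) = *-nonNegative 0≤x (0≤^ n)

  ^-monoʳ-≤ : ∀ {x m n} → 1# ≤ x → m ℕ.≤ n → x ^ m ≤ x ^ n
  ^-monoʳ-≤ {n = n} p z≤n = 1≤^ n p
  ^-monoʳ-≤ {m = ℕ.suc m} p (s≤s m≤n) =
    *-mono-≤ (1≤⇒0≤ p) (1≤⇒0≤ (1≤^ m p)) ≤-refl (^-monoʳ-≤ p m≤n)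

  0≤· : ∀ n → 0# ≤ n · 1#
  0≤· zero      = ≤-refl
  0≤· (ℕ.suc n) = begin
    0#           ≈⟨ +-identityˡ 0# ⟨
    0# + 0#      ≤⟨ +-monoˡ-≤ 0# 0≤1 ⟩
    1# + 0#      ≤⟨ +-monoʳ-≤ 1# (0≤· n) ⟩
    1# + n · 1#  ∎

  ·-mono-≤ : ∀ {x y} n → x ≤ y → n · x ≤ n · y
  ·-mono-≤ zero      p = ≤-refl
  ·-mono-≤ (ℕ.suc n) p = ≤-trans (+-monoˡ-≤ _ p) (+-monoʳ-≤ _ (·-mono-≤ n p))

  ·-cancel-≤ : ∀ m n → m · 1# ≤ n · 1# → m ℕ.≤ n
  ·-cancel-≤ zero      n         p = z≤n
  ·-cancel-≤ (ℕ.suc m) zero      p = contradiction (begin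
    1#           ≈⟨ +-identityʳ 1# ⟨
    1# + 0#      ≤⟨ +-monoʳ-≤ 1# (0≤· m) ⟩
    1# + m · 1#  ≤⟨ p ⟩
    0#           ∎) 1≰0
  ·-cancel-≤ (ℕ.suc m) (ℕ.suc n) p = s≤s (·-cancel-≤ m n (begin
    m · 1#                  ≈⟨ cancel (m · 1#) ⟨
    - 1# + (1# + m · 1#)    ≤⟨ +-monoʳ-≤ (- 1#) p ⟩
    - 1# + (1# + n · 1#)    ≈⟨ cancel (n · 1#) ⟩
    n · 1#                  ∎))
    where
    cancel : ∀ x → - 1# + (1# + x) ≈ x
    cancel x = trans (sym (+-assoc (- 1#) 1# x))
                 (trans (+-congʳ (-‿inverseˡ 1#)) (+-identityˡ x))

  module _ {τ} (1<τ : 1# < τ) where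

    1≤τ : 1# ≤ τ
    1≤τ = proj₁ 1<τ

    τ≰1 : ¬ (τ ≤ 1#)
    τ≰1 p = proj₂ 1<τ (antisym 1≤τ p)

    -- τ * t ≤ t gives 0 ≤ (τ - 1) * (t - 1) ≤ 1 - τ.
    τt≰t : ∀ {t} → 1# ≤ t → ¬ (τ * t ≤ t)
    τt≰t {t} 1≤t p = τ≰1 (0≤-⇒≤ (begin
      0#            ≤⟨ ≤⇒0≤- p ⟩
      t - τ * t     ≈⟨ +-congʳ (*-identityˡ t) ⟨
      1# * t - τ * t ≈⟨ [y-z]x≈yx-zx t 1# τ ⟨
      (1# - τ) * t  ≤⟨ shrink ⟩
      1# - τ        ∎))
      where
      1-τ≤0 : 1# - τ ≤ 0#
      1-τ≤0 = ≤-trans (+-monoˡ-≤ (- τ) 1≤τ) (≤-reflexive (-‿inverseʳ τ))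
      shrink : (1# - τ) * t ≤ 1# - τ
      shrink = 0≤-⇒≤ (begin
        0#  ≤⟨ *-nonNegative (≤⇒0≤- 1-τ≤0) (≤⇒0≤- 1≤t) ⟩
        (0# - (1# - τ)) * (t - 1#)
          ≈⟨ *-congʳ (+-identityˡ _) ⟩
        - (1# - τ) * (t - 1#)
          ≈⟨ expand (1# - τ) t ⟩
        (1# - τ) - (1# - τ) * t ∎)
        where
        expand : ∀ u t → - u * (t - 1#) ≈ u - u * t
        expand u t =
          trans (x[y-z]≈xy-xz (- u) t 1#)
            (trans (+-comm _ _)
              (+-cong (trans (-‿cong (*-identityʳ (- u))) (-‿involutive u))
                      (sym (-‿distribˡ-* u t))))

module RealPower {r} (ℝ : RealField r) where
  open RealField ℝ
  open OrderProperties ℝ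
  open import Algebra.Properties.Semiring.Exp semiring using (_^_; ^-assocʳ)
  open Mult semiring using (×-assocˡ)
  open import Relation.Binary.Reasoning.PartialOrder
    (DecTotalOrder.poset decTotalOrder)

  fromℤ : ℤ → Carrier
  fromℤ (+ n)    = n · 1#
  fromℤ -[1+ n ] = - (ℕ.suc n · 1#)

  -- PowerEq y n τ m says yⁿ = τᵐ for τ ≠ 0, with a negative exponent m
  -- cleared by multiplying both sides by τ⁻ᵐ.
  PowerEq : Carrier → ℕ → Carrier → ℤ → Set r
  PowerEq y n τ (+ m)    = y ^ n ≈ τ ^ m
  PowerEq y n τ -[1+ m ] = y ^ n * τ ^ ℕ.suc m ≈ 1#

  -- y = τ^q: the nonnegative n-th root of τᵐ, where q = m / n.
  IsRationalPower : Carrier → ℚᵘ → Carrier → Set r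
  IsRationalPower τ q y = 0# ≤ y × PowerEq y (↧ₙ q) τ (↥ q)

  _≤ℚ_ : ℚᵘ → Carrier → Set r
  q ≤ℚ x = fromℤ (↥ q) ≤ (↧ₙ q) · x

  -- { τ^q : q rational, q ≤ x }
  RationalPowersUpTo : Carrier → Carrier → Pred Carrier r
  RationalPowersUpTo τ x y = ∃ λ q → q ≤ℚ x × IsRationalPower τ q y

  module _ {τ} (1<τ : 1# < τ) (x : Carrier) where

    nonempty : Satisfiable (RationalPowersUpTo τ x)
    nonempty with archimedean (- x)
    ... | N , -x≤N = y , mkℚᵘ -[1+ N ] 0 , bound , 0≤y , y*t≈1
      where
      t = τ ^ ℕ.suc N

      1≤t : 1# ≤ t
      1≤t = 1≤^ (ℕ.suc N) (1≤τ 1<τ)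

      inv : ∃ λ y → t * y ≈ 1#
      inv = inverse λ t≈0 → 1≰0 (≤-trans 1≤t (≤-reflexive t≈0))

      y = proj₁ inv

      bound : - (ℕ.suc N · 1#) ≤ 1 · x
      bound = ≤-trans (neg-antimono (begin
        - x          ≤⟨ -x≤N ⟩
        N · 1#       ≈⟨ +-identityˡ _ ⟨
        0# + N · 1#  ≤⟨ +-monoˡ-≤ _ 0≤1 ⟩
        1# + N · 1#  ∎)) (≤-reflexive (sym (+-identityʳ x)))

      0≤y : 0# ≤ y
      0≤y with total 0# y
      ... | inj₁ p = p
      ... | inj₂ p = contradiction (begin
        1#     ≈⟨ proj₂ inv ⟨
        t * y  ≈⟨ *-comm t y ⟩
        y * t  ≤⟨ *-monoˡ-≤ (1≤⇒0≤ 1≤t) p ⟩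
        0# * t ≈⟨ zeroˡ t ⟩
        0#     ∎) 1≰0

      y*t≈1 : y ^ 1 * t ≈ 1#
      y*t≈1 = trans (*-congʳ (*-identityʳ y)) (trans (*-comm y t) (proj₂ inv))

    bounded : ∃ (UpperBound (RationalPowersUpTo τ x))
    bounded with archimedean x
    ... | N , x≤N = B , below
      where
      B = τ ^ ℕ.suc N

      1≤B : 1# ≤ B
      1≤B = 1≤^ (ℕ.suc N) (1≤τ 1<τ)

      absurd : ∀ {y} q → q ≤ℚ x → PowerEq y (↧ₙ q) τ (↥ q) → ¬ (B ≤ y)
      absurd {y} (mkℚᵘ (+ m) e) q≤x eq B≤y = τt≰t 1<τ (1≤^ k (1≤τ 1<τ)) (begin
        τ ^ ℕ.suc k     ≤⟨ ^-monoʳ-≤ (1≤τ 1<τ) k<d*[1+N] ⟩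
        τ ^ (ℕ.suc N ℕ.* d) ≈⟨ ^-assocʳ τ (ℕ.suc N) d ⟨
        B ^ d           ≤⟨ ^-monoˡ-≤ d (1≤⇒0≤ 1≤B) B≤y ⟩
        y ^ d           ≈⟨ eq ⟩
        τ ^ m           ≤⟨ ^-monoʳ-≤ (1≤τ 1<τ) m≤k ⟩
        τ ^ k           ∎)
        where
        d = ℕ.suc e
        k = d ℕ.* N
        k<d*[1+N] : ℕ.suc k ℕ.≤ ℕ.suc N ℕ.* d
        k<d*[1+N] = ≡.subst (λ j → ℕ.suc j ℕ.≤ ℕ.suc N ℕ.* d) (ℕ.*-comm N d)
                      (ℕ.+-monoˡ-≤ (N ℕ.* d) (s≤s z≤n))
        m≤k : m ℕ.≤ k
        m≤k = ·-cancel-≤ m k (begin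
          m · 1#       ≤⟨ q≤x ⟩
          d · x        ≤⟨ ·-mono-≤ d x≤N ⟩
          d · (N · 1#) ≈⟨ ×-assocˡ 1# d N ⟩
          k · 1#       ∎)
      absurd {y} (mkℚᵘ -[1+ m ] e) q≤x eq B≤y =
        τt≰t 1<τ ≤-refl (begin
          τ * 1#              ≤⟨ *-mono-≤ (1≤⇒0≤ (1≤τ 1<τ)) 0≤1 ≤-refl (1≤^ m (1≤τ 1<τ)) ⟩
          τ ^ ℕ.suc m         ≈⟨ *-identityˡ _ ⟨
          1# * τ ^ ℕ.suc m    ≤⟨ *-monoˡ-≤ (1≤⇒0≤ (1≤^ (ℕ.suc m) (1≤τ 1<τ)))
                                   (1≤^ (ℕ.suc e) (≤-trans 1≤B B≤y)) ⟩
          y ^ ℕ.suc e * τ ^ ℕ.suc m ≈⟨ eq ⟩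
          1#                  ∎)

      below : UpperBound (RationalPowersUpTo τ x) B
      below {y} (q , q≤x , _ , eq) with total y B
      ... | inj₁ y≤B = y≤B
      ... | inj₂ B≤y = contradiction B≤y (absurd q q≤x eq)

  -- τ^x = sup { τ^q : q rational, q ≤ x } for τ > 1.
  power : ∀ {τ} → 1# < τ → Carrier → Carrier
  power {τ} 1<τ x =
    proj₁ (complete (RationalPowersUpTo τ x) (nonempty 1<τ x) (bounded 1<τ x))

  power-isSupremum : ∀ {τ} (1<τ : 1# < τ) x →
                     IsSupremum (RationalPowersUpTo τ x) (power 1<τ x)
  power-isSupremum {τ} 1<τ x =
    proj₂ (complete (RationalPowersUpTo τ x) (nonempty 1<τ x) (bounded 1<τ x))

-- Each value τ^q with q ≤ x rational is approximated by supporting lines of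
-- C(z) = τ^z: for every N there is a slope s with τ^q + s (z − x) ≤ C(z) + O(1/N)
-- for all z.  For k with Σ k = p, the points z_i = μ − (p a_i + c) have the
-- k-weighted mean x = μ − (Σ k_i a_i + c), so averaging the two families of
-- lines (for a and for b) with weights k cancels the slope terms and leaves
-- τ^q + τ^q′ ≤ max_i f(i) + O(1/N).  Let N → ∞, then pass to the suprema over
-- q and q′.  The lines come from Bernoulli's inequality applied to the powers
-- of a root of τ, and no functional equation for τ^x is needed.

{-# OPTIONS --safe #-}
module Submission where

open import Defs
open import Algebra.Bundles using (RawRing)
open import Algebra.Properties.Semiring.Sum using (sum)
open import Algebra.Solver.Ring.AlmostCommutativeRing
  using (_-Raw-AlmostCommutative⟶_; fromCommutativeRing)
open import Data.Fin.Base using (Fin; zero; suc)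
open import Data.Integer.Base as ℤ using (ℤ; +_; -[1+_]; _⊖_; _◃_)
import Data.Integer.Properties as ℤ
open import Data.List.Base using (allFin)
import Data.List.Extrema as Extremum
open import Data.List.Membership.Propositional.Properties using (∈-allFin)
import Data.List.Relation.Unary.All as All
open import Data.Maybe.Base using (Maybe)
import Data.Maybe.Base as Maybe
open import Data.Nat.Base as ℕ using (ℕ; zero; suc)
import Data.Nat.Properties as ℕ
open import Data.Nat.Tactic.RingSolver using (solve-∀)
open import Data.Product.Base using (∃; _×_; _,_; proj₁; proj₂)
open import Data.Rational.Unnormalised.Base using (mkℚᵘ; ↧ₙ_)
import Data.Sign.Base as Sign
open import Data.Sum.Base using (inj₁; inj₂)
open import Data.Vec.Functional using (Vector)
open import Relation.Binary.Bundles using (DecTotalOrder)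
open import Relation.Binary.PropositionalEquality.Core as ≡ using (_≡_)
open import Relation.Nullary.Decidable using (Dec; yes; no; dec⇒maybe)
open import Relation.Nullary.Negation using (¬_; contradiction)
open import Relation.Unary using (U)

module SupportingLines {r} (ℝ : RealField r) where
  open RealField ℝ hiding (zero)
  open OrderProperties ℝ
  open RealPower ℝ
  open import Algebra.Properties.AbelianGroup +-abelianGroup using (⁻¹-∙-comm)
  open import Algebra.Properties.CommutativeSemigroup +-commutativeSemigroup
    using (interchange)
  open import Algebra.Properties.CommutativeSemiring.Exp commutativeSemiring
    using (_^_; ^-congˡ; ^-congʳ; ^-homo-*; ^-assocʳ; ^-distrib-*)
  open import Algebra.Properties.Ring ring
    using (-‿distribˡ-*; -‿distribʳ-*; -‿involutive; -0#≈0#; [y-z]x≈yx-zx)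
  open import Algebra.Properties.Semiring.Mult semiring
    using (×-homo-+; ×1-homo-*; ×-assoc-*; ×-congʳ)
  open import Algebra.Properties.Semiring.Sum semiring
    using (sum-cong-≋; sum-replicate-zero; *-distribʳ-sum; ∑-distrib-+)
  open import Relation.Binary.Reasoning.PartialOrder
    (DecTotalOrder.poset decTotalOrder)

  -- The ring homomorphism from the integers, and a ring solver with integer coefficients.

  fromℤ-⊖ : ∀ m n → fromℤ (m ⊖ n) ≈ m · 1# - n · 1#
  fromℤ-⊖ zero    zero    = sym (-‿inverseʳ 0#)
  fromℤ-⊖ zero    (suc n) = sym (+-identityˡ _)
  fromℤ-⊖ (suc m) zero    = sym (trans (+-congˡ -0#≈0#) (+-identityʳ _))
  fromℤ-⊖ (suc m) (suc n) rewrite ℤ.[1+m]⊖[1+n]≡m⊖n m n = begin-equality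
    fromℤ (m ⊖ n)                      ≈⟨ fromℤ-⊖ m n ⟩
    m · 1# - n · 1#                    ≈⟨ +-congʳ (+-identityʳ _) ⟨
    m · 1# + 0# - n · 1#               ≈⟨ +-congʳ (+-congˡ (-‿inverseʳ 1#)) ⟨
    m · 1# + (1# - 1#) - n · 1#        ≈⟨ +-congʳ (+-assoc _ _ _) ⟨
    m · 1# + 1# - 1# - n · 1#          ≈⟨ +-congʳ (+-congʳ (+-comm _ _)) ⟩
    1# + m · 1# - 1# - n · 1#          ≈⟨ +-assoc _ _ _ ⟩
    1# + m · 1# + (- 1# - n · 1#)      ≈⟨ +-congˡ (⁻¹-∙-comm _ _) ⟩
    1# + m · 1# - (1# + n · 1#)        ∎

  fromℤ-homo-+ : ∀ i j → fromℤ (i ℤ.+ j) ≈ fromℤ i + fromℤ j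
  fromℤ-homo-+ (+ m)    (+ n)    = ×-homo-+ 1# m n
  fromℤ-homo-+ (+ m)    -[1+ n ] = fromℤ-⊖ m (suc n)
  fromℤ-homo-+ -[1+ m ] (+ n)    = trans (fromℤ-⊖ n (suc m)) (+-comm _ _)
  fromℤ-homo-+ -[1+ m ] -[1+ n ] = begin-equality
    - (suc (suc (m ℕ.+ n)) · 1#)       ≡⟨ ≡.cong (λ k → - (suc k · 1#)) (ℕ.+-suc m n) ⟨
    - ((suc m ℕ.+ suc n) · 1#)         ≈⟨ -‿cong (×-homo-+ 1# (suc m) (suc n)) ⟩
    - (suc m · 1# + suc n · 1#)        ≈⟨ ⁻¹-∙-comm _ _ ⟨
    - (suc m · 1#) - suc n · 1#        ∎

  -- A product of integers with one negative factor computes to `Sign.- ◃ n`, which stays stuck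
  -- until `n` is known to be zero or a successor.
  fromℤ-neg◃ : ∀ n → fromℤ (Sign.- ◃ n) ≈ - (n · 1#)
  fromℤ-neg◃ zero    = sym -0#≈0#
  fromℤ-neg◃ (suc n) = refl

  fromℤ-homo-* : ∀ i j → fromℤ (i ℤ.* j) ≈ fromℤ i * fromℤ j
  fromℤ-homo-* (+ m) (+ n) rewrite ℤ.+◃n≡+n (m ℕ.* n) = ×1-homo-* m n
  fromℤ-homo-* (+ m) -[1+ n ] = begin-equality
    fromℤ (Sign.- ◃ (m ℕ.* suc n))     ≈⟨ fromℤ-neg◃ (m ℕ.* suc n) ⟩
    - ((m ℕ.* suc n) · 1#)             ≈⟨ -‿cong (×1-homo-* m (suc n)) ⟩
    - (m · 1# * suc n · 1#)            ≈⟨ -‿distribʳ-* _ _ ⟩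
    m · 1# * - (suc n · 1#)            ∎
  fromℤ-homo-* -[1+ m ] (+ n) = begin-equality
    fromℤ (Sign.- ◃ (suc m ℕ.* n))     ≈⟨ fromℤ-neg◃ (suc m ℕ.* n) ⟩
    - ((suc m ℕ.* n) · 1#)             ≈⟨ -‿cong (×1-homo-* (suc m) n) ⟩
    - (suc m · 1# * n · 1#)            ≈⟨ -‿distribˡ-* _ _ ⟩
    - (suc m · 1#) * n · 1#            ∎
  fromℤ-homo-* -[1+ m ] -[1+ n ] = begin-equality
    (suc m ℕ.* suc n) · 1#             ≈⟨ ×1-homo-* (suc m) (suc n) ⟩
    suc m · 1# * suc n · 1#            ≈⟨ -‿involutive _ ⟨
    - - (suc m · 1# * suc n · 1#)      ≈⟨ -‿cong (-‿distribʳ-* _ _) ⟩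
    - (suc m · 1# * - (suc n · 1#))    ≈⟨ -‿distribˡ-* _ _ ⟩
    - (suc m · 1#) * - (suc n · 1#)    ∎

  fromℤ-homo-neg : ∀ i → fromℤ (ℤ.- i) ≈ - fromℤ i
  fromℤ-homo-neg (+ zero)  = sym -0#≈0#
  fromℤ-homo-neg (+ suc n) = refl
  fromℤ-homo-neg -[1+ n ]  = sym (-‿involutive _)

  -- Agrees with fromℤ, except that the coefficient 1 must denote 1# itself
  -- (not 1# + 0#) for the solver to recognise it.
  ⟦_⟧ : ℤ → Carrier
  ⟦ + 1 ⟧ = 1#
  ⟦ i   ⟧ = fromℤ i

  ⟦⟧≈fromℤ : ∀ i → ⟦ i ⟧ ≈ fromℤ i
  ⟦⟧≈fromℤ (+ 0)           = refl
  ⟦⟧≈fromℤ (+ 1)           = sym (+-identityʳ 1#)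
  ⟦⟧≈fromℤ (+ suc (suc n)) = refl
  ⟦⟧≈fromℤ -[1+ n ]        = refl

  ℤ-rawRing : RawRing _ _
  ℤ-rawRing = record
    { Carrier = ℤ ; _≈_ = _≡_ ; _+_ = ℤ._+_ ; _*_ = ℤ._*_ ; -_ = ℤ.-_
    ; 0# = + 0 ; 1# = + 1 }

  ℤ-morphism : ℤ-rawRing -Raw-AlmostCommutative⟶ fromCommutativeRing commutativeRing
  ℤ-morphism = record
    { ⟦_⟧    = ⟦_⟧
    ; +-homo = λ i j → trans (⟦⟧≈fromℤ (i ℤ.+ j))
                 (trans (fromℤ-homo-+ i j) (sym (+-cong (⟦⟧≈fromℤ i) (⟦⟧≈fromℤ j))))
    ; *-homo = λ i j → trans (⟦⟧≈fromℤ (i ℤ.* j))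
                 (trans (fromℤ-homo-* i j) (sym (*-cong (⟦⟧≈fromℤ i) (⟦⟧≈fromℤ j))))
    ; -‿homo = λ i → trans (⟦⟧≈fromℤ (ℤ.- i))
                 (trans (fromℤ-homo-neg i) (-‿cong (sym (⟦⟧≈fromℤ i))))
    ; 0-homo = refl
    ; 1-homo = refl
    }

  _coeff≟_ : ∀ i j → Maybe (⟦ i ⟧ ≈ ⟦ j ⟧)
  i coeff≟ j = Maybe.map (λ i≡j → reflexive (≡.cong ⟦_⟧ i≡j)) (dec⇒maybe (i ℤ.≟ j))

  open import Algebra.Solver.Ring ℤ-rawRing (fromCommutativeRing commutativeRing)
    ℤ-morphism _coeff≟_
    using (solve; con; _:=_; _:+_; _:*_; _:-_; :-_)

  -- Ordered-field inequalities and the Archimedean property.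

  -- Splits an inequality into a nonnegative certificate `s` and a ring identity that the solver can
  -- check.
  ≤-by : ∀ {x y s} → 0# ≤ s → s ≈ y - x → x ≤ y
  ≤-by 0≤s s≈y-x = 0≤-⇒≤ (≤-trans 0≤s (≤-reflexive s≈y-x))

  ≰⇒-≰0 : ∀ {x y} → ¬ (x ≤ y) → ¬ (x - y ≤ 0#)
  ≰⇒-≰0 {x} {y} x≰y x-y≤0 = x≰y (≤-by (≤⇒0≤- x-y≤0)
    (solve 2 (λ x y → con (+ 0) :- (x :- y) := y :- x) refl x y))

  1≤1+ : ∀ {x} → 0# ≤ x → 1# ≤ 1# + x
  1≤1+ {x} 0≤x = ≤-by 0≤x (solve 1 (λ x → x := con (+ 1) :+ x :- con (+ 1)) refl x)

  +-nonNegative : ∀ {x y} → 0# ≤ x → 0# ≤ y → 0# ≤ x + y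
  +-nonNegative {x} {y} 0≤x 0≤y = begin
    0#      ≤⟨ 0≤x ⟩
    x       ≈⟨ +-identityʳ x ⟨
    x + 0#  ≤⟨ +-monoʳ-≤ x 0≤y ⟩
    x + y   ∎

  inverse-nonNegative : ∀ {x y} → 0# ≤ x → x * y ≈ 1# → 0# ≤ y
  inverse-nonNegative {x} {y} 0≤x xy≈1 with total 0# y
  ... | inj₁ 0≤y = 0≤y
  ... | inj₂ y≤0 = contradiction
    (≤-by (*-nonNegative 0≤x (≤⇒0≤- y≤0))
      (trans (solve 2 (λ x y → x :* (con (+ 0) :- y) := con (+ 0) :- x :* y) refl x y)
        (+-congˡ (-‿cong xy≈1))))
    1≰0

  positive-inverse : ∀ {x} → ¬ (x ≤ 0#) → 0# ≤ x × ∃ λ y → 0# ≤ y × x * y ≈ 1#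
  positive-inverse {x} x≰0 with total 0# x | inverse (λ x≈0 → x≰0 (≤-reflexive x≈0))
  ... | inj₂ x≤0 | _        = contradiction x≤0 x≰0
  ... | inj₁ 0≤x | y , xy≈1 = 0≤x , y , inverse-nonNegative 0≤x xy≈1 , xy≈1

  *-cancelʳ-≤ : ∀ {x y z} → ¬ (z ≤ 0#) → x * z ≤ y * z → x ≤ y
  *-cancelʳ-≤ {x} {y} {z} z≰0 xz≤yz with positive-inverse z≰0
  ... | _ , h , 0≤h , zh≈1 = begin
    x           ≈⟨ cancel x ⟨
    x * z * h   ≤⟨ *-monoˡ-≤ 0≤h xz≤yz ⟩
    y * z * h   ≈⟨ cancel y ⟩
    y           ∎
    where
    cancel : ∀ w → w * z * h ≈ w
    cancel w = trans (*-assoc w z h) (trans (*-congˡ zh≈1) (*-identityʳ w))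

  1≤⇒≰0 : ∀ {x} → 1# ≤ x → ¬ (x ≤ 0#)
  1≤⇒≰0 1≤x x≤0 = 1≰0 (≤-trans 1≤x x≤0)

  x≤x*y : ∀ {x y} → 0# ≤ x → 1# ≤ y → x ≤ x * y
  x≤x*y {x} {y} 0≤x 1≤y = ≤-by (*-nonNegative 0≤x (≤⇒0≤- 1≤y))
    (solve 2 (λ x y → x :* (y :- con (+ 1)) := x :* y :- x) refl x y)

  -- This serves as the limit `N → ∞`. If `w` were positive with inverse `h`, then
  -- `1 + N ≤ K * h ≤ N` for an Archimedean bound `N` of `K * h`.
  multiples-bounded⇒≤0 : ∀ {w K} → (∀ N → suc N · 1# * w ≤ K) → w ≤ 0#
  multiples-bounded⇒≤0 {w} {K} bound with w ≤? 0#
  ... | yes w≤0 = w≤0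
  ... | no  w≰0 with positive-inverse w≰0
  ...   | 0≤w , h , 0≤h , wh≈1 with archimedean (K * h)
  ...     | N , Kh≤N = contradiction
    (≤-by (≤⇒0≤- (begin
      1# + N · 1#            ≈⟨ *-identityʳ _ ⟨
      (1# + N · 1#) * 1#     ≈⟨ *-congˡ wh≈1 ⟨
      (1# + N · 1#) * (w * h) ≈⟨ *-assoc _ w h ⟨
      (1# + N · 1#) * w * h  ≤⟨ *-monoˡ-≤ 0≤h (bound N) ⟩
      K * h                  ≤⟨ Kh≤N ⟩
      N · 1#                 ∎))
      (solve 1 (λ n → n :- (con (+ 1) :+ n) := con (+ 0) :- con (+ 1)) refl (N · 1#)))
    1≰0

  -- Descends from an Archimedean upper bound by one unit at a time until the lower inequality
  -- holds.
  floor : ∀ {z} → 0# ≤ z → ∃ λ n → n · 1# ≤ z × z ≤ suc n · 1#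
  floor {z} 0≤z with archimedean z
  ... | N , z≤N = below N z≤N
    where
    below : ∀ N → z ≤ N · 1# → ∃ λ n → n · 1# ≤ z × z ≤ suc n · 1#
    below zero    z≤0 = 0 , 0≤z , ≤-trans z≤0 (0≤· 1)
    below (suc N) z≤1+N with total z (N · 1#)
    ... | inj₁ z≤N = below N z≤N
    ... | inj₂ N≤z = N , N≤z , z≤1+N

  -- Natural powers and their tangents.

  0≤^ : ∀ {x} n → 0# ≤ x → 0# ≤ x ^ n
  0≤^ zero    0≤x = 0≤1
  0≤^ (suc n) 0≤x = *-nonNegative 0≤x (0≤^ n 0≤x)

  1^n≈1 : ∀ n → 1# ^ n ≈ 1#
  1^n≈1 zero    = refl
  1^n≈1 (suc n) = trans (*-identityˡ _) (1^n≈1 n)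

  -- The forward difference at b is a valid slope to the left of b as well.
  ^-above-tangent : ∀ {v} → 1# ≤ v → ∀ a b →
                    v ^ b + v ^ b * (a · 1# - b · 1#) * (v - 1#) ≤ v ^ a
  ^-above-tangent {v} 1≤v zero zero = ≤-reflexive
    (solve 1 (λ v → con (+ 1) :+ con (+ 1) :* (con (+ 0) :- con (+ 0)) :* (v :- con (+ 1))
      := con (+ 1)) refl v)
  -- Bernoulli's inequality: multiplying the case `a` by `v` leaves the surplus `a * e * e`.
  ^-above-tangent {v} 1≤v (suc a) zero = ≤-by
    (+-nonNegative
      (*-nonNegative (1≤⇒0≤ 1≤v) (≤⇒0≤- (^-above-tangent 1≤v a zero)))
      (*-nonNegative (0≤· a) (*-nonNegative (≤⇒0≤- 1≤v) (≤⇒0≤- 1≤v))))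
    (solve 3 (λ v n x → let o = con (+ 1) ; e = v :- o in
      v :* (x :- (o :+ o :* (n :- con (+ 0)) :* e)) :+ n :* (e :* e)
      := v :* x :- (o :+ o :* (o :+ n :- con (+ 0)) :* e)) refl v (a · 1#) (v ^ a))
  -- Bernoulli's inequality for the exponent `- b`, with `v ^ b` cleared; the surplus is again a
  -- nonnegative multiple of `e * e`.
  ^-above-tangent {v} 1≤v zero (suc b) = ≤-by
    (+-nonNegative
      (≤⇒0≤- (^-above-tangent 1≤v zero b))
      (*-nonNegative (*-nonNegative (1≤⇒0≤ (1≤^ b 1≤v)) (0≤· (suc b)))
        (*-nonNegative (≤⇒0≤- 1≤v) (≤⇒0≤- 1≤v))))
    (solve 3 (λ v n y → let o = con (+ 1) ; e = v :- o in
      (o :- (y :+ y :* (con (+ 0) :- n) :* e)) :+ y :* (o :+ n) :* (e :* e)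
      := o :- (v :* y :+ v :* y :* (con (+ 0) :- (o :+ n)) :* e)) refl v (b · 1#) (v ^ b))
  -- Both sides scale by `v`, so the induction ends in a case where one exponent is `0`.
  ^-above-tangent {v} 1≤v (suc a) (suc b) = ≤-by
    (*-nonNegative (1≤⇒0≤ 1≤v) (≤⇒0≤- (^-above-tangent 1≤v a b)))
    (solve 5 (λ v m n x y → let o = con (+ 1) ; e = v :- o in
      v :* (x :- (y :+ y :* (m :- n) :* e))
      := v :* x :- (v :* y :+ v :* y :* (o :+ m :- (o :+ n)) :* e))
      refl v (a · 1#) (b · 1#) (v ^ a) (v ^ b))

  -- Uniqueness and existence of roots.

  -- Whichever of `x` and `y` is smaller, comparing `x ^ n` with `y ^ n` in the equation gives the
  -- opposite inequality once `y ^ n`, which is at least 1, is cancelled.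
  ^-cancelˡ-≈ : ∀ n {x y} → 0# ≤ x → 1# ≤ y → x ^ suc n ≈ y ^ suc n → x ≈ y
  ^-cancelˡ-≈ n {x} {y} 0≤x 1≤y eq with total x y
  ... | inj₁ x≤y = antisym x≤y (*-cancelʳ-≤ (1≤⇒≰0 (1≤^ n 1≤y)) (begin
    y * y ^ n  ≈⟨ eq ⟨
    x * x ^ n  ≈⟨ *-comm _ _ ⟩
    x ^ n * x  ≤⟨ *-monoˡ-≤ 0≤x (^-monoˡ-≤ n 0≤x x≤y) ⟩
    y ^ n * x  ≈⟨ *-comm _ _ ⟩
    x * y ^ n  ∎))
  ... | inj₂ y≤x = antisym (*-cancelʳ-≤ (1≤⇒≰0 (1≤^ n 1≤y)) (begin
    x * y ^ n  ≈⟨ *-comm _ _ ⟩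
    y ^ n * x  ≤⟨ *-monoˡ-≤ 0≤x (^-monoˡ-≤ n (1≤⇒0≤ 1≤y) y≤x) ⟩
    x ^ n * x  ≈⟨ *-comm _ _ ⟩
    x * x ^ n  ≈⟨ eq ⟩
    y * y ^ n  ∎)) y≤x

  -- The tangent of (1 + ε)^j at j = n, evaluated at j = 0, is below 1.
  ^-scale-bound : ∀ {z ε} n → 0# ≤ z → 0# ≤ ε →
                  (z * (1# + ε)) ^ n * (1# - n · 1# * ε) ≤ z ^ n
  ^-scale-bound {z} {ε} n 0≤z 0≤ε = begin
    (z * (1# + ε)) ^ n * (1# - n · 1# * ε)
      ≈⟨ *-congʳ (^-distrib-* z (1# + ε) n) ⟩
    z ^ n * (1# + ε) ^ n * (1# - n · 1# * ε)
      ≈⟨ solve 4 (λ x y k e → let o = con (+ 1) in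
           x :* y :* (o :- k :* e)
           := (y :+ y :* (con (+ 0) :- k) :* (o :+ e :- o)) :* x)
           refl (z ^ n) ((1# + ε) ^ n) (n · 1#) ε ⟩
    ((1# + ε) ^ n + (1# + ε) ^ n * (0# - n · 1#) * (1# + ε - 1#)) * z ^ n
      ≤⟨ *-monoˡ-≤ (0≤^ n 0≤z) (^-above-tangent (1≤1+ 0≤ε) 0 n) ⟩
    1# * z ^ n
      ≈⟨ *-identityˡ _ ⟩
    z ^ n ∎

  -- Provides the relative step for perturbing a trial root: `g` is the gap between its power and
  -- the target, and `K` measures how fast the gap closes. The witness is `g / (1 + K)`.
  small : ∀ {K g} → 0# ≤ K → ¬ (g ≤ 0#) →
          ∃ λ ε → 0# ≤ ε × ¬ (ε ≤ 0#) × (1# + K) * ε ≈ g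
  small {K} {g} 0≤K g≰0 with positive-inverse (1≤⇒≰0 (1≤1+ 0≤K)) | positive-inverse g≰0
  ... | 0≤1+K , h , 0≤h , [1+K]h≈1 | 0≤g , _ =
    g * h , *-nonNegative 0≤g 0≤h , gh≰0 , [1+K]gh≈g
    where
    [1+K]gh≈g : (1# + K) * (g * h) ≈ g
    [1+K]gh≈g = begin-equality
      (1# + K) * (g * h)  ≈⟨ solve 3 (λ x y z → x :* (y :* z) := y :* (x :* z)) refl (1# + K) g h ⟩
      g * ((1# + K) * h)  ≈⟨ *-congˡ [1+K]h≈1 ⟩
      g * 1#              ≈⟨ *-identityʳ g ⟩
      g                   ∎
    gh≰0 : ¬ (g * h ≤ 0#)
    gh≰0 gh≤0 = g≰0 (begin
      g                   ≈⟨ [1+K]gh≈g ⟨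
      (1# + K) * (g * h)  ≈⟨ *-comm _ _ ⟩
      g * h * (1# + K)    ≤⟨ *-monoˡ-≤ 0≤1+K gh≤0 ⟩
      0# * (1# + K)       ≈⟨ zeroˡ _ ⟩
      0#                  ∎)

  x[1+ε]≰x : ∀ {x ε} → 1# ≤ x → 0# ≤ ε → ¬ (ε ≤ 0#) → ¬ (x * (1# + ε) ≤ x)
  x[1+ε]≰x {x} {ε} 1≤x 0≤ε ε≰0 p = ε≰0 (≤-by
    (+-nonNegative (≤⇒0≤- p) (*-nonNegative (≤⇒0≤- 1≤x) 0≤ε))
    (solve 2 (λ x e → let o = con (+ 1) in
      x :- x :* (o :+ e) :+ (x :- o) :* e := con (+ 0) :- e) refl x ε))

  x+ε≰x : ∀ {x ε} → ¬ (ε ≤ 0#) → ¬ (x + ε ≤ x)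
  x+ε≰x {x} {ε} ε≰0 p = ε≰0 (≤-by (≤⇒0≤- p)
    (solve 2 (λ x e → x :- (x :+ e) := con (+ 0) :- e) refl x ε))

  -- For `ε` from `small` with `K = k * x`, the loss `k * x * ε` uses up all of the gap between `x`
  -- and `y` except `ε`.
  x[1-kε]≈y+ε : ∀ {x y k ε} → (1# + k * x) * ε ≈ x - y → x * (1# - k * ε) ≈ y + ε
  x[1-kε]≈y+ε {x} {y} {k} {ε} eq = begin-equality
    x * (1# - k * ε)          ≈⟨ solve 3 (λ x k e → let o = con (+ 1) in
                                   x :* (o :- k :* e) := x :+ e :- (o :+ k :* x) :* e) refl x k ε ⟩
    x + ε - (1# + k * x) * ε  ≈⟨ +-congˡ (-‿cong eq) ⟩
    x + ε - (x - y)           ≈⟨ solve 3 (λ x e y → x :+ e :- (x :- y) := y :+ e) refl x ε y ⟩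
    y + ε                     ∎

  -- Scales `y` up to `w = y * (1 + ε)`. If `a ≤ w ^ n`, then `^-scale-bound` would put
  -- `a * (1 - n * ε)` below `y ^ n`, although it equals `y ^ n + ε`.
  ^-increase : ∀ {a y} n → 1# ≤ a → 1# ≤ y → ¬ (a ≤ y ^ n) →
               ∃ λ w → 1# ≤ w × w ^ n ≤ a × ¬ (w ≤ y)
  ^-increase {a} {y} n 1≤a 1≤y a≰yⁿ =
    increase (small (*-nonNegative (0≤· n) (1≤⇒0≤ 1≤a)) (≰⇒-≰0 a≰yⁿ))
    where
    increase : (∃ λ ε → 0# ≤ ε × ¬ (ε ≤ 0#) × (1# + n · 1# * a) * ε ≈ a - y ^ n) →
               ∃ λ w → 1# ≤ w × w ^ n ≤ a × ¬ (w ≤ y)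
    increase (ε , 0≤ε , ε≰0 , eq) =
      w , 1≤* 1≤y (1≤1+ 0≤ε) , wⁿ≤a , x[1+ε]≰x 1≤y 0≤ε ε≰0
      where
      w = y * (1# + ε)
      wⁿ≤a : w ^ n ≤ a
      wⁿ≤a with total (w ^ n) a | total 0# (1# - n · 1# * ε)
      ... | inj₁ p    | _ = p
      ... | inj₂ a≤wⁿ | inj₁ 0≤1-nε = contradiction (begin
        y ^ n + ε                   ≈⟨ x[1-kε]≈y+ε eq ⟨
        a * (1# - n · 1# * ε)       ≤⟨ *-monoˡ-≤ 0≤1-nε a≤wⁿ ⟩
        w ^ n * (1# - n · 1# * ε)   ≤⟨ ^-scale-bound n (1≤⇒0≤ 1≤y) 0≤ε ⟩
        y ^ n                       ∎) (x+ε≰x ε≰0)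
      -- The inequality `a ≤ w ^ n` cannot be multiplied by a factor that may be negative, but here
      -- `a * (1 - n * ε) ≤ 0 ≤ y ^ n` directly.
      ... | inj₂ a≤wⁿ | inj₂ 1-nε≤0 = contradiction (begin
        y ^ n + ε                   ≈⟨ x[1-kε]≈y+ε eq ⟨
        a * (1# - n · 1# * ε)       ≈⟨ *-comm _ _ ⟩
        (1# - n · 1# * ε) * a       ≤⟨ *-monoˡ-≤ (1≤⇒0≤ 1≤a) 1-nε≤0 ⟩
        0# * a                      ≈⟨ zeroˡ a ⟩
        0#                          ≤⟨ 1≤⇒0≤ (1≤^ n 1≤y) ⟩
        y ^ n                       ∎) (x+ε≰x ε≰0)

  -- Scales `y` down to `u = y / (1 + ε)`, so that `^-scale-bound` at `u` gives
  -- `u ^ n ≥ y ^ n * (1 - n * ε) = a + ε`.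
  ^-decrease : ∀ {a y} n → 1# ≤ y → ¬ (y ^ n ≤ a) →
               ∃ λ u → 0# ≤ u × ¬ (u ^ n ≤ a) × ¬ (y ≤ u)
  ^-decrease {a} {y} n 1≤y yⁿ≰a =
    decrease (small (*-nonNegative (0≤· n) (1≤⇒0≤ (1≤^ n 1≤y))) (≰⇒-≰0 yⁿ≰a))
    where
    decrease : (∃ λ ε → 0# ≤ ε × ¬ (ε ≤ 0#) × (1# + n · 1# * y ^ n) * ε ≈ y ^ n - a) →
               ∃ λ u → 0# ≤ u × ¬ (u ^ n ≤ a) × ¬ (y ≤ u)
    decrease (ε , 0≤ε , ε≰0 , eq) with positive-inverse (1≤⇒≰0 (1≤1+ 0≤ε))
    ... | _ , h , 0≤h , [1+ε]h≈1 = u , 0≤u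
      , (λ uⁿ≤a → x+ε≰x ε≰0 (≤-trans a+ε≤uⁿ uⁿ≤a))
      , (λ y≤u → x[1+ε]≰x (≤-trans 1≤y y≤u) 0≤ε ε≰0 (≤-trans (≤-reflexive u[1+ε]≈y) y≤u))
      where
      u = y * h
      0≤u : 0# ≤ u
      0≤u = *-nonNegative (1≤⇒0≤ 1≤y) 0≤h
      u[1+ε]≈y : u * (1# + ε) ≈ y
      u[1+ε]≈y = begin-equality
        y * h * (1# + ε)    ≈⟨ *-assoc _ _ _ ⟩
        y * (h * (1# + ε))  ≈⟨ *-congˡ (*-comm _ _) ⟩
        y * ((1# + ε) * h)  ≈⟨ *-congˡ [1+ε]h≈1 ⟩
        y * 1#              ≈⟨ *-identityʳ y ⟩
        y                   ∎
      a+ε≤uⁿ : a + ε ≤ u ^ n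
      a+ε≤uⁿ = begin
        a + ε                                   ≈⟨ x[1-kε]≈y+ε eq ⟨
        y ^ n * (1# - n · 1# * ε)               ≈⟨ *-congʳ (^-congˡ n u[1+ε]≈y) ⟨
        (u * (1# + ε)) ^ n * (1# - n · 1# * ε)  ≤⟨ ^-scale-bound n 0≤u 0≤ε ⟩
        u ^ n                                   ∎

  -- The root is the supremum `y` of `S`. A power of `y` below `a` would let `^-increase` produce a
  -- member of `S` beyond `y`; a power above `a` would let `^-decrease` produce a smaller upper
  -- bound.
  root : ∀ {a} → 1# ≤ a → ∀ n → ∃ λ v → 1# ≤ v × v ^ suc n ≈ a
  root {a} 1≤a n = supremum-is-root (complete S (1# , 1∈S) (a , S≤a))
    where
    S : Carrier → Set r
    S t = 1# ≤ t × t ^ suc n ≤ a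

    1∈S : S 1#
    1∈S = ≤-refl , ≤-trans (≤-reflexive (1^n≈1 (suc n))) 1≤a

    S≤a : UpperBound S a
    S≤a (1≤t , tᵐ≤a) = ≤-trans (x≤x*y (1≤⇒0≤ 1≤t) (1≤^ n 1≤t)) tᵐ≤a

    supremum-is-root : ∃ (IsSupremum S) → ∃ λ v → 1# ≤ v × v ^ suc n ≈ a
    supremum-is-root (y , S≤y , least) = y , 1≤y , antisym yᵐ≤a a≤yᵐ
      where
      1≤y : 1# ≤ y
      1≤y = S≤y 1∈S

      a≤yᵐ : a ≤ y ^ suc n
      a≤yᵐ with a ≤? y ^ suc n
      ... | yes p = p
      ... | no a≰yᵐ =
        let w , 1≤w , wᵐ≤a , w≰y = ^-increase (suc n) 1≤a 1≤y a≰yᵐ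
        in contradiction (S≤y (1≤w , wᵐ≤a)) w≰y

      yᵐ≤a : y ^ suc n ≤ a
      yᵐ≤a with y ^ suc n ≤? a
      ... | yes p = p
      ... | no yᵐ≰a =
        let u , 0≤u , uᵐ≰a , y≰u = ^-decrease (suc n) 1≤y yᵐ≰a
        in contradiction (least (S≤ 0≤u uᵐ≰a)) y≰u
        where
        S≤ : ∀ {u} → 0# ≤ u → ¬ (u ^ suc n ≤ a) → UpperBound S u
        S≤ {u} 0≤u uᵐ≰a {t} (_ , tᵐ≤a) with total t u
        ... | inj₁ t≤u = t≤u
        ... | inj₂ u≤t = contradiction (≤-trans (^-monoˡ-≤ (suc n) 0≤u u≤t) tᵐ≤a) uᵐ≰a

  -- Integer exponents as differences of natural numbers.

  *-cancelʳ-≈ : ∀ {x y z} → ¬ (z ≤ 0#) → x * z ≈ y * z → x ≈ y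
  *-cancelʳ-≈ z≰0 xz≈yz = antisym
    (*-cancelʳ-≤ z≰0 (≤-reflexive xz≈yz))
    (*-cancelʳ-≤ z≰0 (≤-reflexive (sym xz≈yz)))

  -- Common factors `τ` are cancelled until one exponent is `0`; there `PowerEq` is the given
  -- equation, up to a factor 1.
  PowerEq-⊖⁺ : ∀ {y n τ} → 1# ≤ τ → ∀ a b →
               y ^ n * τ ^ b ≈ τ ^ a → PowerEq y n τ (a ⊖ b)
  PowerEq-⊖⁺ 1≤τ zero    zero    eq = trans (sym (*-identityʳ _)) eq
  PowerEq-⊖⁺ 1≤τ zero    (suc b) eq = eq
  PowerEq-⊖⁺ 1≤τ (suc a) zero    eq = trans (sym (*-identityʳ _)) eq
  PowerEq-⊖⁺ {y} {n} {τ} 1≤τ (suc a) (suc b) eq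
    rewrite ℤ.[1+m]⊖[1+n]≡m⊖n a b = PowerEq-⊖⁺ 1≤τ a b
      (*-cancelʳ-≈ (1≤⇒≰0 1≤τ) (begin-equality
        y ^ n * τ ^ b * τ    ≈⟨ *-assoc _ _ _ ⟩
        y ^ n * (τ ^ b * τ)  ≈⟨ *-congˡ (*-comm _ _) ⟩
        y ^ n * (τ * τ ^ b)  ≈⟨ eq ⟩
        τ * τ ^ a            ≈⟨ *-comm _ _ ⟩
        τ ^ a * τ            ∎))

  -- Puts exponents of either sign into one form, so that later arguments need no case distinction
  -- on the sign.
  PowerEq-⊖⁻ : ∀ {y n τ} i → PowerEq y n τ i →
               ∃ λ a → ∃ λ b → fromℤ i ≈ a · 1# - b · 1# × y ^ n * τ ^ b ≈ τ ^ a
  PowerEq-⊖⁻ (+ m)    eq = m , 0 , fromℤ-⊖ m 0 , trans (*-identityʳ _) eq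
  PowerEq-⊖⁻ -[1+ m ] eq = 0 , suc m , fromℤ-⊖ 0 (suc m) , eq

  ·≈·1* : ∀ n x → n · x ≈ n · 1# * x
  ·≈·1* n x = trans (×-congʳ n (sym (*-identityˡ x))) (sym (×-assoc-* n 1# x))

  1≤suc·1 : ∀ n → 1# ≤ suc n · 1#
  1≤suc·1 n = 1≤1+ (0≤· n)

  -- The power function and its supporting lines.

  module _ {τ} (1<τ : 1# < τ) where

    C : Carrier → Carrier
    C = power 1<τ

    rationalPower≤C : ∀ q {x y} → q ≤ℚ x → IsRationalPower τ q y → y ≤ C x
    rationalPower≤C q {x} q≤x y≈τ^q = proj₁ (power-isSupremum 1<τ x) (q , q≤x , y≈τ^q)

    C-least : ∀ {x b} → (∀ q {y} → q ≤ℚ x → IsRationalPower τ q y → y ≤ b) → C x ≤ b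
    C-least {x} bound = proj₂ (power-isSupremum 1<τ x) λ (q , q≤x , y≈τ^q) → bound q q≤x y≈τ^q

    C-mono : ∀ {x y} → x ≤ y → C x ≤ C y
    C-mono x≤y = C-least λ q q≤x → rationalPower≤C q (≤-trans q≤x (·-mono-≤ (↧ₙ q) x≤y))

    C-cong : ∀ {x y} → x ≈ y → C x ≈ C y
    C-cong x≈y = antisym (C-mono (≤-reflexive x≈y)) (C-mono (≤-reflexive (sym x≈y)))

    module _ d {v} (1≤v : 1# ≤ v) (v^D≈τ : v ^ suc d ≈ τ) where

      τ^≈v^ : ∀ n → τ ^ n ≈ v ^ (suc d ℕ.* n)
      τ^≈v^ n = trans (^-congˡ n (sym v^D≈τ)) (^-assocʳ v (suc d) n)

      -- g = v^(a − b) for the integer a − b = ⌊ D z ⌋.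
      v-power-below : ∀ z → ∃ λ a → ∃ λ b → ∃ λ g →
        g * v ^ b ≈ v ^ a × suc d · 1# * z ≤ suc a · 1# - b · 1# × g ≤ C z
      v-power-below z with archimedean (- (suc d · 1# * z)) | positive-inverse (1≤⇒≰0 1≤v)
      ... | b , -Dz≤b | _ , h , 0≤h , vh≈1 = below (floor 0≤Dz+b)
        where
        D = suc d · 1#

        -- The shift by `b` makes the natural-number `floor` applicable also for negative `z`.
        0≤Dz+b : 0# ≤ D * z + b · 1#
        0≤Dz+b = ≤-trans (≤⇒0≤- -Dz≤b)
          (≤-reflexive (solve 2 (λ w b → b :- (:- w) := w :+ b) refl (D * z) (b · 1#)))

        below : (∃ λ a → a · 1# ≤ D * z + b · 1# × D * z + b · 1# ≤ suc a · 1#) →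
                ∃ λ a → ∃ λ b → ∃ λ g →
                g * v ^ b ≈ v ^ a × suc d · 1# * z ≤ suc a · 1# - b · 1# × g ≤ C z
        below (a , a≤Dz+b , Dz+b≤1+a) = a , b , g , gv^b≈v^a
          , ≤-by (≤⇒0≤- Dz+b≤1+a)
              (solve 3 (λ s w b → s :- (w :+ b) := s :- b :- w) refl (suc a · 1#) (D * z) (b · 1#))
          -- `g` is the rational power of `τ` with exponent `(a - b) / D`; `mkℚᵘ` stores the
          -- denominator minus one, hence `d`.
          , rationalPower≤C (mkℚᵘ (a ⊖ b) d) a-b≤Dz (0≤g , PowerEq-⊖⁺ (1≤τ 1<τ) a b g^Dτ^b≈τ^a)
          where
          g = v ^ a * h ^ b

          gv^b≈v^a : g * v ^ b ≈ v ^ a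
          gv^b≈v^a = begin-equality
            v ^ a * h ^ b * v ^ b    ≈⟨ *-assoc _ _ _ ⟩
            v ^ a * (h ^ b * v ^ b)  ≈⟨ *-congˡ (^-distrib-* h v b) ⟨
            v ^ a * (h * v) ^ b      ≈⟨ *-congˡ (^-congˡ b (trans (*-comm h v) vh≈1)) ⟩
            v ^ a * 1# ^ b           ≈⟨ *-congˡ (1^n≈1 b) ⟩
            v ^ a * 1#               ≈⟨ *-identityʳ _ ⟩
            v ^ a                    ∎

          0≤g : 0# ≤ g
          0≤g = *-nonNegative (1≤⇒0≤ (1≤^ a 1≤v)) (0≤^ b 0≤h)

          τ^≈[v^]^D : ∀ n → τ ^ n ≈ (v ^ n) ^ suc d
          τ^≈[v^]^D n = trans (τ^≈v^ n)
            (trans (^-congʳ v (ℕ.*-comm (suc d) n)) (sym (^-assocʳ v n (suc d))))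

          g^Dτ^b≈τ^a : g ^ suc d * τ ^ b ≈ τ ^ a
          g^Dτ^b≈τ^a = begin-equality
            g ^ suc d * τ ^ b            ≈⟨ *-congˡ (τ^≈[v^]^D b) ⟩
            g ^ suc d * (v ^ b) ^ suc d  ≈⟨ ^-distrib-* g (v ^ b) (suc d) ⟨
            (g * v ^ b) ^ suc d          ≈⟨ ^-congˡ (suc d) gv^b≈v^a ⟩
            (v ^ a) ^ suc d              ≈⟨ τ^≈[v^]^D a ⟨
            τ ^ a                        ∎

          a-b≤Dz : fromℤ (a ⊖ b) ≤ suc d · z
          a-b≤Dz = begin
            fromℤ (a ⊖ b)    ≈⟨ fromℤ-⊖ a b ⟩
            a · 1# - b · 1#  ≤⟨ ≤-by (≤⇒0≤- a≤Dz+b)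
                                  (solve 3 (λ a w b → w :+ b :- a := w :- (a :- b)) refl (a · 1#) (D * z) (b · 1#)) ⟩
            D * z            ≈⟨ ·≈·1* (suc d) z ⟨
            suc d · z        ∎

    -- With D = n (N + 1) and v the D-th root of τ, both τ^q and the lower
    -- bound v^⌊Dz⌋ of C z are integral powers of v, so the tangent of the
    -- discrete exponential at q has slope s = τ^q D (v − 1); rounding costs
    -- at most δ = τ^q (v − 1).
    supporting-line : ∀ q {x y} → q ≤ℚ x → IsRationalPower τ q y → ∀ N →
      ∃ λ s → ∃ λ δ → suc N · 1# * δ ≤ y * (τ - 1#) ×
                      (∀ z → y + s * (z - x) ≤ C z + δ)
    supporting-line q@(mkℚᵘ i n′) {x} {y} q≤x (0≤y , y^n≈τ^i) N
      with PowerEq-⊖⁻ {y} {suc n′} i y^n≈τ^i | root (1≤τ 1<τ) (N ℕ.+ n′ ℕ.* suc N)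
    ... | m₁ , m₂ , i≈m₁-m₂ , y^nτ^m₂≈τ^m₁ | v , 1≤v , v^D≈τ =
      y * (D * e) , y * e , Nδ≤ , above
      where
      n = suc n′
      k = suc N
      -- Chosen so that `suc d` is definitionally `n ℕ.* k`.
      d = N ℕ.+ n′ ℕ.* suc N
      D = suc d · 1#
      e = v - 1#
      b₁ = m₁ ℕ.* k
      b₂ = m₂ ℕ.* k

      0≤e : 0# ≤ e
      0≤e = ≤⇒0≤- 1≤v

      D≈nk : D ≈ n · 1# * k · 1#
      D≈nk = ×1-homo-* n k

      -- Bernoulli's inequality gives `D * e ≤ v ^ suc d - 1 = τ - 1`, and `k ≤ n * k = D`.
      Nδ≤ : k · 1# * (y * e) ≤ y * (τ - 1#)
      Nδ≤ = begin
        k · 1# * (y * e)         ≤⟨ *-monoˡ-≤ (*-nonNegative 0≤y 0≤e)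
                                      (x≤x*y (0≤· k) (1≤suc·1 n′)) ⟩
        k · 1# * n · 1# * (y * e)
                                 ≈⟨ *-congʳ (trans (*-comm _ _) (sym D≈nk)) ⟩
        D * (y * e)              ≈⟨ solve 3 (λ D y v → let o = con (+ 1) ; e = v :- o in
                                      D :* (y :* e)
                                      := (o :+ o :* (D :- con (+ 0)) :* e :- o) :* y) refl D y v ⟩
        (1# + 1# * (D - 0#) * e - 1#) * y
                                 ≤⟨ *-monoˡ-≤ 0≤y (+-monoˡ-≤ (- 1#) (^-above-tangent 1≤v (suc d) 0)) ⟩
        (v ^ suc d - 1#) * y     ≈⟨ *-congʳ (+-congʳ v^D≈τ) ⟩
        (τ - 1#) * y             ≈⟨ *-comm _ _ ⟩
        y * (τ - 1#)             ∎

      τ^≈[v^]^n : ∀ m → τ ^ m ≈ (v ^ (m ℕ.* k)) ^ n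
      τ^≈[v^]^n m = trans (τ^≈v^ d 1≤v v^D≈τ m)
        (trans (^-congʳ v (rearrange n k m)) (sym (^-assocʳ v (m ℕ.* k) n)))
        where
        rearrange : ∀ n k m → n ℕ.* k ℕ.* m ≡ m ℕ.* k ℕ.* n
        rearrange = solve-∀

      -- Both sides have the same `n`-th power, since `τ` is the power of `v` with exponent `n * k`.
      -- Hence `y` is the integral power of `v` with exponent `b₁ - b₂`.
      yv^b₂≈v^b₁ : y * v ^ b₂ ≈ v ^ b₁
      yv^b₂≈v^b₁ = ^-cancelˡ-≈ n′ (*-nonNegative 0≤y (1≤⇒0≤ (1≤^ b₂ 1≤v))) (1≤^ b₁ 1≤v)
        (begin-equality
          (y * v ^ b₂) ^ n       ≈⟨ ^-distrib-* y (v ^ b₂) n ⟩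
          y ^ n * (v ^ b₂) ^ n   ≈⟨ *-congˡ (τ^≈[v^]^n m₂) ⟨
          y ^ n * τ ^ m₂         ≈⟨ y^nτ^m₂≈τ^m₁ ⟩
          τ ^ m₁                 ≈⟨ τ^≈[v^]^n m₁ ⟩
          (v ^ b₁) ^ n           ∎)

      b₁-b₂≤Dx : b₁ · 1# - b₂ · 1# ≤ D * x
      b₁-b₂≤Dx = begin
        b₁ · 1# - b₂ · 1#        ≈⟨ +-cong (×1-homo-* m₁ k) (-‿cong (×1-homo-* m₂ k)) ⟩
        m₁ · 1# * k · 1# - m₂ · 1# * k · 1#
                                 ≈⟨ [y-z]x≈yx-zx _ _ _ ⟨
        (m₁ · 1# - m₂ · 1#) * k · 1#
                                 ≈⟨ *-congʳ i≈m₁-m₂ ⟨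
        fromℤ i * k · 1#         ≤⟨ *-monoˡ-≤ (0≤· k) q≤x ⟩
        n · x * k · 1#           ≈⟨ *-congʳ (·≈·1* n x) ⟩
        n · 1# * x * k · 1#      ≈⟨ solve 3 (λ n x k → n :* x :* k := n :* k :* x) refl (n · 1#) x (k · 1#) ⟩
        n · 1# * k · 1# * x      ≈⟨ *-congʳ D≈nk ⟨
        D * x                    ∎

      above : ∀ z → y + y * (D * e) * (z - x) ≤ C z + y * e
      above z = through (v-power-below d 1≤v v^D≈τ z)
        where
        through : (∃ λ a → ∃ λ b → ∃ λ g →
          g * v ^ b ≈ v ^ a × D * z ≤ suc a · 1# - b · 1# × g ≤ C z) →
          y + y * (D * e) * (z - x) ≤ C z + y * e
        through (a , b , g , gv^b≈v^a , Dz≤1+a-b , g≤Cz) = begin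
          y + y * (D * e) * (z - x)
            ≈⟨ solve 5 (λ y D e z x → y :+ y :* (D :* e) :* (z :- x)
                 := y :+ (D :* z :- D :* x) :* (y :* e)) refl y D e z x ⟩
          y + (D * z - D * x) * (y * e)
            ≤⟨ +-monoʳ-≤ y (*-monoˡ-≤ (*-nonNegative 0≤y 0≤e) Dz-Dx≤T+1) ⟩
          y + (T + 1#) * (y * e)
            ≈⟨ solve 3 (λ y T e → y :+ (T :+ con (+ 1)) :* (y :* e)
                 := y :+ y :* T :* e :+ y :* e) refl y T e ⟩
          y + y * T * e + y * e
            ≤⟨ +-monoˡ-≤ (y * e) tangent≤g ⟩
          g + y * e
            ≤⟨ +-monoˡ-≤ (y * e) g≤Cz ⟩
          C z + y * e ∎
          where
          -- Multiplication by `W` turns `y` and `g` into the natural powers `v ^ (b₁ + b)` and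
          -- `v ^ (a + b₂)`, whose exponents differ by `T`.
          W = v ^ b₂ * v ^ b
          T = (a · 1# + b₂ · 1#) - (b₁ · 1# + b · 1#)

          -- The extra 1 comes from rounding `D * z` down; multiplied by `y * e` it becomes the
          -- error `δ`.
          Dz-Dx≤T+1 : D * z - D * x ≤ T + 1#
          Dz-Dx≤T+1 = ≤-by (+-nonNegative (≤⇒0≤- Dz≤1+a-b) (≤⇒0≤- b₁-b₂≤Dx))
            (solve 6 (λ w w′ a b b₁ b₂ → let o = con (+ 1) in
              (o :+ a :- b :- w) :+ (w′ :- (b₁ :- b₂))
              := a :+ b₂ :- (b₁ :+ b) :+ o :- (w :- w′))
              refl (D * z) (D * x) (a · 1#) (b · 1#) (b₁ · 1#) (b₂ · 1#))

          v^[b₁+b]≈yW : v ^ (b₁ ℕ.+ b) ≈ y * W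
          v^[b₁+b]≈yW = begin-equality
            v ^ (b₁ ℕ.+ b)         ≈⟨ ^-homo-* v b₁ b ⟩
            v ^ b₁ * v ^ b         ≈⟨ *-congʳ yv^b₂≈v^b₁ ⟨
            y * v ^ b₂ * v ^ b     ≈⟨ *-assoc _ _ _ ⟩
            y * W                  ∎

          v^[a+b₂]≈gW : v ^ (a ℕ.+ b₂) ≈ g * W
          v^[a+b₂]≈gW = begin-equality
            v ^ (a ℕ.+ b₂)         ≈⟨ ^-homo-* v a b₂ ⟩
            v ^ a * v ^ b₂         ≈⟨ *-congʳ gv^b≈v^a ⟨
            g * v ^ b * v ^ b₂     ≈⟨ solve 3 (λ g x y → g :* x :* y := g :* (y :* x)) refl g (v ^ b) (v ^ b₂) ⟩
            g * W                  ∎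

          tangent≤g : y + y * T * e ≤ g
          tangent≤g = *-cancelʳ-≤ (1≤⇒≰0 (1≤* (1≤^ b₂ 1≤v) (1≤^ b 1≤v))) (begin
            (y + y * T * e) * W
              ≈⟨ solve 4 (λ y m e W → (y :+ y :* m :* e) :* W := y :* W :+ y :* W :* m :* e)
                   refl y T e W ⟩
            y * W + y * W * T * e
              ≈⟨ +-cong v^[b₁+b]≈yW (*-congʳ (*-cong v^[b₁+b]≈yW
                   (+-cong (×-homo-+ 1# a b₂) (-‿cong (×-homo-+ 1# b₁ b))))) ⟨
            v ^ (b₁ ℕ.+ b) + v ^ (b₁ ℕ.+ b) * ((a ℕ.+ b₂) · 1# - (b₁ ℕ.+ b) · 1#) * e
              ≤⟨ ^-above-tangent 1≤v (a ℕ.+ b₂) (b₁ ℕ.+ b) ⟩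
            v ^ (a ℕ.+ b₂)
              ≈⟨ v^[a+b₂]≈gW ⟩
            g * W ∎)

    -- The suprema are taken one after the other: with `y` fixed, `M - y` bounds every `y′` and so
    -- `C x′`; then `M - C x′` bounds every `y` and so `C x`.
    two-supremum-bound : ∀ {x x′ M} →
      (∀ q {y} → q ≤ℚ x → IsRationalPower τ q y →
       ∀ q′ {y′} → q′ ≤ℚ x′ → IsRationalPower τ q′ y′ → y + y′ ≤ M) →
      C x + C x′ ≤ M
    two-supremum-bound {x} {x′} {M} bound =
      ≤-by (≤⇒0≤- Cx≤M-Cx′) (solve 3 (λ c c′ M → M :- c′ :- c := M :- (c :+ c′)) refl (C x) (C x′) M)
      where
      y≤M-Cx′ : ∀ q {y} → q ≤ℚ x → IsRationalPower τ q y → y ≤ M - C x′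
      y≤M-Cx′ q {y} q≤x y≈τ^q = ≤-by (≤⇒0≤- Cx′≤M-y)
        (solve 3 (λ y c′ M → M :- y :- c′ := M :- c′ :- y) refl y (C x′) M)
        where
        Cx′≤M-y : C x′ ≤ M - y
        Cx′≤M-y = C-least λ q′ {y′} q′≤x′ y′≈τ^q′ →
          ≤-by (≤⇒0≤- (bound q q≤x y≈τ^q q′ q′≤x′ y′≈τ^q′))
            (solve 3 (λ y y′ M → M :- (y :+ y′) := M :- y :- y′) refl y y′ M)
      Cx≤M-Cx′ : C x ≤ M - C x′
      Cx≤M-Cx′ = C-least y≤M-Cx′

  -- Weighted sums and the vertices of the simplex.

  Σ : ∀ {n} → Vector Carrier n → Carrier
  Σ = sum semiring

  Σ-nonNegative : ∀ {n} (k : Vector Carrier n) → (∀ i → 0# ≤ k i) → 0# ≤ Σ k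
  Σ-nonNegative {zero}  k 0≤k = ≤-refl
  Σ-nonNegative {suc n} k 0≤k = +-nonNegative (0≤k zero) (Σ-nonNegative (λ i → k (suc i)) (λ i → 0≤k (suc i)))

  Σ-weighted-≤ : ∀ {n E} (k t : Vector Carrier n) → (∀ i → 0# ≤ k i) → (∀ i → t i ≤ E) →
                 Σ (λ i → k i * t i) ≤ Σ k * E
  Σ-weighted-≤ {zero}  {E} k t 0≤k t≤E = ≤-reflexive (sym (zeroˡ E))
  Σ-weighted-≤ {suc n} {E} k t 0≤k t≤E = begin
    k zero * t zero + Σ (λ i → k (suc i) * t (suc i))
      ≤⟨ +-monoʳ-≤ _ (Σ-weighted-≤ (λ i → k (suc i)) (λ i → t (suc i)) (λ i → 0≤k (suc i)) (λ i → t≤E (suc i))) ⟩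
    k zero * t zero + Σ (λ i → k (suc i)) * E
      ≤⟨ +-monoˡ-≤ _ (≤-by (*-nonNegative (0≤k zero) (≤⇒0≤- (t≤E zero)))
           (solve 3 (λ k t E → k :* (E :- t) := k :* E :- k :* t) refl (k zero) (t zero) E)) ⟩
    k zero * E + Σ (λ i → k (suc i)) * E
      ≈⟨ distribʳ E _ _ ⟨
    (k zero + Σ (λ i → k (suc i))) * E ∎

  -- Nonnegative weights of total at most 0 all vanish. This handles `p = 0`, where division by the
  -- total weight is impossible.
  Σ-zero-weights : ∀ {n} (k t : Vector Carrier n) → (∀ i → 0# ≤ k i) → Σ k ≤ 0# →
                   Σ (λ i → k i * t i) ≈ 0#
  Σ-zero-weights {zero}  k t 0≤k Σk≤0 = refl
  Σ-zero-weights {suc n} k t 0≤k Σk≤0 = begin-equality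
    k zero * t zero + Σ (λ i → k (suc i) * t (suc i))
      ≈⟨ +-cong (*-congʳ k₀≈0) (Σ-zero-weights (λ i → k (suc i)) (λ i → t (suc i)) (λ i → 0≤k (suc i)) rest≤0) ⟩
    0# * t zero + 0#
      ≈⟨ trans (+-identityʳ _) (zeroˡ _) ⟩
    0# ∎
    where
    rest = Σ (λ i → k (suc i))
    k₀≈0 : k zero ≈ 0#
    k₀≈0 = antisym (≤-trans (≤-by (Σ-nonNegative (λ i → k (suc i)) (λ i → 0≤k (suc i)))
      (solve 2 (λ k r → r := k :+ r :- k) refl (k zero) rest)) Σk≤0) (0≤k zero)
    rest≤0 : rest ≤ 0#
    rest≤0 = ≤-trans (≤-by (0≤k zero)
      (solve 2 (λ k r → k := k :+ r :- r) refl (k zero) rest)) Σk≤0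

  -- A vertex of the simplex of weights with total `p`: the `i`-th unit vector scaled by `p`.
  point : ∀ {n} → Fin n → Carrier → Vector Carrier n
  point zero    p zero    = p
  point zero    p (suc j) = 0#
  point (suc i) p zero    = 0#
  point (suc i) p (suc j) = point i p j

  point-nonNegative : ∀ {n p} (i : Fin n) → 0# ≤ p → ∀ j → 0# ≤ point i p j
  point-nonNegative zero    0≤p zero    = 0≤p
  point-nonNegative zero    0≤p (suc j) = ≤-refl
  point-nonNegative (suc i) 0≤p zero    = ≤-refl
  point-nonNegative (suc i) 0≤p (suc j) = point-nonNegative i 0≤p j

  Σ-point : ∀ {n} (i : Fin n) p (t : Vector Carrier n) → Σ (λ j → point i p j * t j) ≈ p * t i
  Σ-point {suc n} zero p t = trans (+-congˡ (Σ-zero-weights (λ (_ : Fin n) → 0#) (λ j → t (suc j))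
    (λ _ → ≤-refl) (≤-reflexive (sum-replicate-zero n)))) (+-identityʳ _)
  Σ-point (suc i) p t = trans (+-cong (zeroˡ _) (Σ-point i p (λ j → t (suc j)))) (+-identityˡ _)

  Σ-point-total : ∀ {n} (i : Fin n) p → Σ (point i p) ≈ p
  Σ-point-total i p = trans (sum-cong-≋ (λ j → sym (*-identityʳ (point i p j))))
    (trans (Σ-point i p (λ _ → 1#)) (*-identityʳ p))

  -- Each difference collapses to `X - p * a i`. Weighted by `k`, both terms sum to `p * X`: the
  -- first because the weights have total `p`, the second by the definition of `X`.
  Σ-centred : ∀ {n p} (k a : Vector Carrier n) μ c s → Σ k ≈ p →
              let X = Σ (λ i → k i * a i) in
              Σ (λ i → k i * (s * (μ - (p * a i + c) - (μ - (X + c))))) ≈ 0#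
  Σ-centred {n} {p} k a μ c s Σk≈p = begin-equality
    Σ (λ i → k i * (s * (μ - (p * a i + c) - (μ - (X + c)))))
      ≈⟨ sum-cong-≋ (λ i → solve 7 (λ k s μ p a c X →
           k :* (s :* (μ :- (p :* a :+ c) :- (μ :- (X :+ c))))
           := k :* (s :* X) :+ k :* a :* (:- (s :* p))) refl (k i) s μ p (a i) c X) ⟩
    Σ (λ i → k i * (s * X) + k i * a i * - (s * p))
      ≈⟨ ∑-distrib-+ (λ i → k i * (s * X)) (λ i → k i * a i * - (s * p)) ⟩
    Σ (λ i → k i * (s * X)) + Σ (λ i → k i * a i * - (s * p))
      ≈⟨ +-cong (*-distribʳ-sum (s * X) k) (*-distribʳ-sum (- (s * p)) (λ i → k i * a i)) ⟨
    Σ k * (s * X) + X * - (s * p)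
      ≈⟨ +-congʳ (*-congʳ Σk≈p) ⟩
    p * (s * X) + X * - (s * p)
      ≈⟨ solve 3 (λ p s X → p :* (s :* X) :+ X :* (:- (s :* p)) := con (+ 0)) refl p s X ⟩
    0# ∎
    where
    X = Σ (λ i → k i * a i)

  argmax : ∀ {n} (f : Fin (suc n) → Carrier) → ∃ λ i → ∀ j → f j ≤ f i
  -- The index `zero` is the initial candidate, available because the index set is nonempty.
  argmax f = E.argmax f zero (allFin _) ,
    λ j → All.lookup (E.f[xs]≤f[argmax] {f = f} zero (allFin _)) (∈-allFin j)
    where
    module E = Extremum (DecTotalOrder.totalOrder decTotalOrder)

  -- Jensen's inequality for the sum of two exponentials.

  module _ {τ} (1<τ : 1# < τ) where

    -- For rational powers `y` and `y′` below the two values of `C`, the product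
    -- `(N + 1) * (y + y′ - M)` has a bound independent of `N`, which forces `y + y′ ≤ M`.
    jensen : ∀ {n p μ c d M} (k a b : Vector Carrier n) →
      (∀ i → 0# ≤ k i) → Σ k ≈ p → ¬ (p ≤ 0#) →
      (∀ i → C 1<τ (μ - (p * a i + c)) + C 1<τ (μ - (p * b i + d)) ≤ M) →
      C 1<τ (μ - (Σ (λ i → k i * a i) + c)) + C 1<τ (μ - (Σ (λ i → k i * b i) + d)) ≤ M
    jensen {n} {p} {μ} {c} {d} {M} k a b 0≤k Σk≈p p≰0 f≤M =
      two-supremum-bound 1<τ λ q {y} q≤x y≈τ^q q′ {y′} q′≤x′ y′≈τ^q′ →
        ≤-by (≤⇒0≤- (multiples-bounded⇒≤0 λ N →
            approximate N (supporting-line 1<τ q q≤x y≈τ^q N) (supporting-line 1<τ q′ q′≤x′ y′≈τ^q′ N)))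
          (solve 3 (λ y y′ M → con (+ 0) :- (y :+ y′ :- M) := M :- (y :+ y′)) refl y y′ M)
      where
      X = Σ (λ i → k i * a i)
      Y = Σ (λ i → k i * b i)

      Supported : ℕ → Carrier → Carrier → Set r
      Supported N x y = ∃ λ s → ∃ λ δ → suc N · 1# * δ ≤ y * (τ - 1#) ×
                        (∀ z → y + s * (z - x) ≤ C 1<τ z + δ)

      approximate : ∀ {y y′} N → Supported N (μ - (X + c)) y → Supported N (μ - (Y + d)) y′ →
                    suc N · 1# * (y + y′ - M) ≤ y * (τ - 1#) + y′ * (τ - 1#)
      approximate {y} {y′} N (s , δ , Nδ≤ , line) (s′ , δ′ , Nδ′≤ , line′) = begin
        suc N · 1# * (y + y′ - M)
          ≈⟨ *-comm _ _ ⟩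
        (y + y′ - M) * suc N · 1#
          ≤⟨ *-monoˡ-≤ (0≤· (suc N)) (≤-by 0≤E
               (solve 5 (λ y y′ M δ δ′ → M :+ (δ :+ δ′) :- (y :+ y′)
                 := δ :+ δ′ :- (y :+ y′ :- M)) refl y y′ M δ δ′)) ⟩
        (δ + δ′) * suc N · 1#
          ≈⟨ solve 3 (λ N δ δ′ → (δ :+ δ′) :* N := N :* δ :+ N :* δ′) refl (suc N · 1#) δ δ′ ⟩
        suc N · 1# * δ + suc N · 1# * δ′
          ≤⟨ ≤-trans (+-monoˡ-≤ _ Nδ≤) (+-monoʳ-≤ _ Nδ′≤) ⟩
        y * (τ - 1#) + y′ * (τ - 1#) ∎
        where
        E = M + (δ + δ′) - (y + y′)

        t t′ : Fin n → Carrier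
        t  i = s * (μ - (p * a i + c) - (μ - (X + c)))
        t′ i = s′ * (μ - (p * b i + d) - (μ - (Y + d)))

        t+t′≤E : ∀ i → t i + t′ i ≤ E
        t+t′≤E i = ≤-by (≤⇒0≤- sum≤)
          (solve 4 (λ y y′ u m → m :- (y :+ y′ :+ u) := m :- (y :+ y′) :- u)
            refl y y′ (t i + t′ i) (M + (δ + δ′)))
          where
          sum≤ : y + y′ + (t i + t′ i) ≤ M + (δ + δ′)
          sum≤ = begin
            y + y′ + (t i + t′ i)    ≈⟨ interchange y y′ (t i) (t′ i) ⟩
            y + t i + (y′ + t′ i)    ≤⟨ ≤-trans (+-monoˡ-≤ _ (line _)) (+-monoʳ-≤ _ (line′ _)) ⟩
            C 1<τ (μ - (p * a i + c)) + δ + (C 1<τ (μ - (p * b i + d)) + δ′)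
                                     ≈⟨ interchange _ δ _ δ′ ⟩
            C 1<τ (μ - (p * a i + c)) + C 1<τ (μ - (p * b i + d)) + (δ + δ′)
                                     ≤⟨ +-monoˡ-≤ (δ + δ′) (f≤M i) ⟩
            M + (δ + δ′)             ∎

        Σk[t+t′]≈0 : Σ (λ i → k i * (t i + t′ i)) ≈ 0#
        Σk[t+t′]≈0 = begin-equality
          Σ (λ i → k i * (t i + t′ i))
            ≈⟨ sum-cong-≋ (λ i → distribˡ (k i) (t i) (t′ i)) ⟩
          Σ (λ i → k i * t i + k i * t′ i)
            ≈⟨ ∑-distrib-+ (λ i → k i * t i) (λ i → k i * t′ i) ⟩
          Σ (λ i → k i * t i) + Σ (λ i → k i * t′ i)
            ≈⟨ +-cong (Σ-centred k a μ c s Σk≈p) (Σ-centred k b μ d s′ Σk≈p) ⟩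
          0# + 0#
            ≈⟨ +-identityˡ 0# ⟩
          0# ∎

        -- The slope terms have weighted sum 0 and none exceeds `E`, so `0 ≤ p * E`; the positive
        -- `p` is then cancelled.
        0≤E : 0# ≤ E
        0≤E = *-cancelʳ-≤ p≰0 (begin
          0# * p                        ≈⟨ zeroˡ p ⟩
          0#                            ≈⟨ Σk[t+t′]≈0 ⟨
          Σ (λ i → k i * (t i + t′ i))  ≤⟨ Σ-weighted-≤ k (λ i → t i + t′ i) 0≤k t+t′≤E ⟩
          Σ k * E                       ≈⟨ *-congʳ Σk≈p ⟩
          p * E                         ≈⟨ *-comm p E ⟩
          E * p                         ∎)

-- Equality of the maximum over the simplex with the maximum over its vertices.

lemma5 : ∀ {r} (ℝ : RealField r) →
    let open RealField ℝ
        open RealPower ℝ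
        Σ : ∀ {n} → Vector Carrier n → Carrier
        Σ = sum semiring
    in
    ∀ {τ} (1<τ : 1# < τ) →
    let C = power 1<τ in
    ∀ (ℓ : ℕ) → 1 ℕ.≤ ℓ →
    ∀ (p μ c d : Carrier) → 0# ≤ p → 0# ≤ μ → 0# ≤ c → 0# ≤ d →
    ∀ (a b : Fin ℓ → Carrier) → (∀ i → 0# ≤ a i) → (∀ i → 0# ≤ b i) →
    ∃ λ M →
      IsMaximum
        (λ (k : Fin ℓ → Carrier) → (∀ i → 0# ≤ k i) × Σ k ≈ p)
        (λ k → C (μ - (Σ (λ i → k i * a i) + c)) + C (μ - (Σ (λ i → k i * b i) + d)))
        M
      ×
      IsMaximum
        U
        (λ (i : Fin ℓ) → C (μ - (p * a i + c)) + C (μ - (p * b i + d)))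
        M
lemma5 ℝ {τ} 1<τ (suc n) _ p μ c d 0≤p _ _ _ a b _ _ = maximum-at (argmax f)
  where
  open RealField ℝ hiding (zero)
  open RealPower ℝ
  open SupportingLines ℝ

  f : Fin (suc n) → Carrier
  f i = power 1<τ (μ - (p * a i + c)) + power 1<τ (μ - (p * b i + d))

  F : (Fin (suc n) → Carrier) → Carrier
  F k = power 1<τ (μ - (Σ (λ i → k i * a i) + c)) + power 1<τ (μ - (Σ (λ i → k i * b i) + d))

  F≈f : ∀ k i → Σ (λ j → k j * a j) ≈ p * a i → Σ (λ j → k j * b j) ≈ p * b i → F k ≈ f i
  F≈f k i eq eq′ = +-cong (C-cong 1<τ (+-congˡ (-‿cong (+-congʳ eq))))
                          (C-cong 1<τ (+-congˡ (-‿cong (+-congʳ eq′))))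

  F≤f : ∀ {i} → (∀ j → f j ≤ f i) → ∀ k → (∀ j → 0# ≤ k j) × Σ k ≈ p → Dec (p ≤ 0#) → F k ≤ f i
  F≤f     f≤fi k (0≤k , Σk≈p) (no  p≰0) = jensen 1<τ k a b 0≤k Σk≈p p≰0 f≤fi
  -- Here `p = 0`: the weighted sums and the products with `p` all vanish, so `F k` and `f i` agree.
  F≤f {i} f≤fi k (0≤k , Σk≈p) (yes p≤0) = ≤-reflexive (F≈f k i (degenerate a) (degenerate b))
    where
    degenerate : ∀ t → Σ (λ j → k j * t j) ≈ p * t i
    degenerate t = trans
      (Σ-zero-weights k t 0≤k (≤-trans (≤-reflexive Σk≈p) p≤0))
      (sym (trans (*-congʳ (antisym p≤0 0≤p)) (zeroˡ (t i))))

  maximum-at : (∃ λ i → ∀ j → f j ≤ f i) →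
    ∃ λ M → IsMaximum (λ k → (∀ i → 0# ≤ k i) × Σ k ≈ p) F M × IsMaximum U f M
  maximum-at (i , f≤fi) = f i
    -- The common maximum is the largest vertex value, attained on the simplex at the vertex
    -- `point i p`.
    , ( ( point i p , (point-nonNegative i 0≤p , Σ-point-total i p)
        , F≈f (point i p) i (Σ-point i p a) (Σ-point i p b))
      , λ k k∈simplex → F≤f f≤fi k k∈simplex (p ≤? 0#))
    , ((i , _ , refl) , λ j _ → f≤fi j)
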